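{- Let $A$ be a residuated lattice and let $\tilde{A}$ be the strongly co-Stone hull of $A$. Then $\tilde{A}$ is a strongly co-Stone residuated lattice.
   Context: A residuated lattice is an algebra $(A,\vee,\wedge,\odot,\rightarrow,0,1)$ such that $(A,\vee,\wedge,0,1)$ is a bounded lattice, $(A,\odot,1)$ is a commutative monoid, and $a\leq b\rightarrow c$ iff $a\odot b\leq c$ for all $a,b,c\in A$. A filter of $A$ is a non-empty upward closed subset closed under $\odot$; $\langle x\rangle$ is the filter generated by $x$. $B(A)$ is the Boolean algebra of complemented elements of $A$. For $X\subseteq A$, $X^{\top}=\{a\in A\mid a\vee x=1\text{ for all }x\in X\}$, which is a filter. $A$ is strongly co-Stone iff for all $X\subseteq A$ there exists $e\in B(A)$ with $X^{\top}=\langle e\rangle$. For a filter $F$, $A/F$ is the quotient by the congruence $a\equiv b$ iff $(a\rightarrow b)\wedge(b\rightarrow a)\in F$, and $a/F$ is the class of $a$. Construction of $\tilde{A}$: $\mathrm{CoAnn}(A)=\{X^{\top}\mid X\subseteq A\}$ is a complete Boolean algebra under inclusion, with meet $\cap$, complement $F\mapsto F^{\top}$, least element $\{1\}$, greatest element $A$, and join $\bigvee^{\top}_{t}F_t=(\bigcap_t F_t^{\top})^{\top}$. $\Pi(A)$ is the set of finite partitions of $\mathrm{CoAnn}(A)$, i.e. finite sets $\mathcal{C}$ of elements of $\mathrm{CoAnn}(A)\setminus\{\{1\}\}$, pairwise with intersection $\{1\}$, and with join $A$ (the empty partition occurs only when $A$ is trivial). Order: $\mathcal{C}\leq\mathcal{D}$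 iff $\mathcal{D}$ refines $\mathcal{C}$, i.e. every $D\in\mathcal{D}$ is contained in a (necessarily unique) $C\in\mathcal{C}$; $\Pi(A)$ is directed. Put $A_{\mathcal{C}}=\prod_{C\in\mathcal{C}}A/C^{\top}$, and for $\mathcal{C}\leq\mathcal{D}$ let $\mathcal{P}_{\mathcal{C}\mathcal{D}}:A_{\mathcal{C}}\to A_{\mathcal{D}}$ send $(a_C/C^{\top})_{C\in\mathcal{C}}$ to $(b_D/D^{\top})_{D\in\mathcal{D}}$ with $b_D=a_C$ for the unique $C\in\mathcal{C}$ with $D\subseteq C$. These are injective morphisms forming an inductive system, and $\tilde{A}=\varinjlim_{\mathcal{C}\in\Pi(A)}A_{\mathcal{C}}$ (direct limit in the category of residuated lattices). -}

module Defs where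

open import Level using (_⊔_) renaming (suc to lsuc)
open import Agda.Primitive using (Setω)
open import Algebra.Core using (Op₂)
open import Algebra.Structures using (IsCommutativeMonoid)
open import Axiom.ExcludedMiddle using (ExcludedMiddle)
open import Data.Empty using (⊥-elim)
open import Data.Empty.Polymorphic using (⊥)
open import Data.Unit.Polymorphic using (⊤)
open import Data.Fin.Base using (Fin; zero; suc)
open import Data.Fin.Properties using (_≟_)
open import Data.List.Base using (List; []; _∷_; length; lookup; filter; allFin; cartesianProduct)
open import Data.List.Membership.Propositional using () renaming (_∈_ to _∈ˡ_)
open import Data.List.Membership.Propositional.Properties
  using (∈-filter⁺; ∈-filter⁻; ∈-cartesianProduct⁺; ∈-allFin; ∈-lookup)
open import Data.List.Relation.Unary.All as All using (All)
open import Data.List.Relation.Unary.AllPairs using (_∷_)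
open import Data.List.Relation.Unary.Any using (index)
open import Data.List.Relation.Unary.Any.Properties using (lookup-index)
open import Data.List.Relation.Unary.Unique.Propositional using (Unique)
import Data.List.Relation.Unary.Unique.Propositional.Properties as Unique
open import Data.Nat.Base using (ℕ)
open import Data.Product.Base using (Σ; ∃; _×_; _,_; proj₁; proj₂)
open import Data.Sum.Base using (_⊎_; inj₁; inj₂)
open import Function.Base using (_∘_)
open import Function.Bundles using (_⇔_; mk⇔; Equivalence)
open import Relation.Binary.Core using (Rel)
open import Relation.Binary.Lattice.Bundles using (BoundedLattice)
open import Relation.Binary.Lattice.Definitions using (Supremum; Infimum)
open import Relation.Binary.Lattice.Structures using (IsBoundedLattice)
import Relation.Binary.Lattice.Properties.JoinSemilattice as JoinProperties
import Relation.Binary.Lattice.Properties.MeetSemilattice as MeetProperties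
open import Relation.Binary.Structures using (IsEquivalence)
open import Relation.Binary.PropositionalEquality.Core as ≡ using (_≡_; _≢_)
open import Relation.Nullary using (¬_; Dec; yes; no)
open import Relation.Nullary.Decidable using (¬?)
open import Relation.Unary using (Pred; _∈_; _⊆_; _≐_; _∩_; _∪_; ∅; U; ⋂)

record ResiduatedLattice c ℓ₁ ℓ₂ : Set (lsuc (c ⊔ ℓ₁ ⊔ ℓ₂)) where
  infix  4 _≈_ _≤_
  infixr 5 _⇒_
  infixr 6 _∨_
  infixr 7 _∧_
  infixl 8 _⊙_
  field
    Carrier             : Set c
    _≈_                 : Rel Carrier ℓ₁
    _≤_                 : Rel Carrier ℓ₂
    _∨_ _∧_ _⊙_ _⇒_     : Op₂ Carrier
    𝟘 𝟙                 : Carrier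
    isBoundedLattice    : IsBoundedLattice _≈_ _≤_ _∨_ _∧_ 𝟙 𝟘
    isCommutativeMonoid : IsCommutativeMonoid _≈_ _⊙_ 𝟙
    residuation         : ∀ a b c → (a ≤ b ⇒ c) ⇔ (a ⊙ b ≤ c)

  boundedLattice : BoundedLattice c ℓ₁ ℓ₂
  boundedLattice = record { isBoundedLattice = isBoundedLattice }

  open BoundedLattice boundedLattice public
    using ( refl; trans; antisym; reflexive; supremum; infimum; maximum; minimum
          ; x≤x∨y; y≤x∨y; ∨-least; x∧y≤x; x∧y≤y; ∧-greatest; module Eq
          ; joinSemilattice; meetSemilattice)
  open JoinProperties joinSemilattice public using (∨-monotonic; ∨-cong; ∨-comm)
  open MeetProperties meetSemilattice public using (∧-monotonic; ∧-cong; y≤x⇒x∧y≈y)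
  open IsCommutativeMonoid isCommutativeMonoid public
    using () renaming (∙-cong to ⊙-cong; assoc to ⊙-assoc; comm to ⊙-comm
                      ; identityˡ to ⊙-identityˡ; identityʳ to ⊙-identityʳ)

  curry : ∀ {a b c} → a ⊙ b ≤ c → a ≤ b ⇒ c
  curry = Equivalence.from (residuation _ _ _)

  uncurry : ∀ {a b c} → a ≤ b ⇒ c → a ⊙ b ≤ c
  uncurry = Equivalence.to (residuation _ _ _)

  ⇒-eval : ∀ {a b} → (a ⇒ b) ⊙ a ≤ b
  ⇒-eval = uncurry refl

  ⊙-monoˡ : ∀ {a b c} → a ≤ b → a ⊙ c ≤ b ⊙ c
  ⊙-monoˡ a≤b = uncurry (trans a≤b (curry refl))

  ⊙-monoʳ : ∀ {a b c} → a ≤ b → c ⊙ a ≤ c ⊙ b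
  ⊙-monoʳ a≤b = trans (reflexive (⊙-comm _ _)) (trans (⊙-monoˡ a≤b) (reflexive (⊙-comm _ _)))

  ⊙-mono : ∀ {a b c d} → a ≤ b → c ≤ d → a ⊙ c ≤ b ⊙ d
  ⊙-mono a≤b c≤d = trans (⊙-monoˡ a≤b) (⊙-monoʳ c≤d)

  ⊙≤ˡ : ∀ {a b} → a ⊙ b ≤ a
  ⊙≤ˡ = trans (⊙-monoʳ (maximum _)) (reflexive (⊙-identityʳ _))

  ⊙≤ʳ : ∀ {a b} → a ⊙ b ≤ b
  ⊙≤ʳ = trans (⊙-monoˡ (maximum _)) (reflexive (⊙-identityˡ _))

  ⇒-mono : ∀ {a b c d} → b ≤ a → c ≤ d → a ⇒ c ≤ b ⇒ d
  ⇒-mono b≤a c≤d = curry (trans (⊙-monoʳ b≤a) (trans ⇒-eval c≤d))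

  ⇒-cong : ∀ {a b c d} → a ≈ b → c ≈ d → a ⇒ c ≈ b ⇒ d
  ⇒-cong a≈b c≈d = antisym
    (⇒-mono (reflexive (Eq.sym a≈b)) (reflexive c≈d))
    (⇒-mono (reflexive a≈b) (reflexive (Eq.sym c≈d)))

  𝟙≤⇒≈𝟙 : ∀ {a} → 𝟙 ≤ a → a ≈ 𝟙
  𝟙≤⇒≈𝟙 = antisym (maximum _)

-- All laws reduced to inequalities; `_≈_` only has to be the symmetric part of `_≤_`.
fromInequalities :
  ∀ {c ℓ₁ ℓ₂} {Carrier : Set c} (_≈_ : Rel Carrier ℓ₁) (_≤_ : Rel Carrier ℓ₂)
  (_∨_ _∧_ _⊙_ _⇒_ : Op₂ Carrier) (𝟘 𝟙 : Carrier) →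
  (∀ {x y} → x ≈ y → x ≤ y) → (∀ {x y} → x ≈ y → y ≤ x) →
  (∀ {x y} → x ≤ y → y ≤ x → x ≈ y) →
  (∀ {x} → x ≤ x) → (∀ {x y z} → x ≤ y → y ≤ z → x ≤ z) →
  Supremum _≤_ _∨_ → Infimum _≤_ _∧_ →
  (∀ x → x ≤ 𝟙) → (∀ x → 𝟘 ≤ x) →
  (∀ x y z → ((x ⊙ y) ⊙ z) ≤ (x ⊙ (y ⊙ z))) → (∀ x y → (x ⊙ y) ≤ (y ⊙ x)) →
  (∀ x → (𝟙 ⊙ x) ≤ x) → (∀ x → x ≤ (𝟙 ⊙ x)) →
  (∀ x y z → x ≤ (y ⇒ z) → (x ⊙ y) ≤ z) → (∀ x y z → (x ⊙ y) ≤ z → x ≤ (y ⇒ z)) →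
  ResiduatedLattice c ℓ₁ ℓ₂
fromInequalities {Carrier = Carrier} _≈_ _≤_ _∨_ _∧_ _⊙_ _⇒_ 𝟘 𝟙
  ≈⇒≤ ≈⇒≥ antisym refl trans sup inf max min assoc comm idˡ₁ idˡ₂ uncur cur = record
  { Carrier = Carrier ; _≈_ = _≈_ ; _≤_ = _≤_
  ; _∨_ = _∨_ ; _∧_ = _∧_ ; _⊙_ = _⊙_ ; _⇒_ = _⇒_ ; 𝟘 = 𝟘 ; 𝟙 = 𝟙
  ; isBoundedLattice = record
    { isLattice = record
      { isPartialOrder = record
        { isPreorder = record
          { isEquivalence = isEquivalence ; reflexive = ≈⇒≤ ; trans = trans }
        ; antisym = antisym }
      ; supremum = sup ; infimum = inf }
    ; maximum = max ; minimum = min }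
  ; isCommutativeMonoid = record
    { isMonoid = record
      { isSemigroup = record
        { isMagma = record
          { isEquivalence = isEquivalence
          ; ∙-cong = λ p q → antisym (mono (≈⇒≤ p) (≈⇒≤ q)) (mono (≈⇒≥ p) (≈⇒≥ q)) }
        ; assoc = λ x y z → antisym (assoc x y z)
            (trans (comm _ _) (trans (assoc _ _ _)
              (trans (comm _ _) (trans (assoc _ _ _) (comm _ _))))) }
      ; identity = (λ x → antisym (idˡ₁ x) (idˡ₂ x))
                 , (λ x → antisym (trans (comm _ _) (idˡ₁ x)) (trans (idˡ₂ x) (comm _ _))) }
    ; comm = λ x y → antisym (comm x y) (comm y x) }
  ; residuation = λ a b c → mk⇔ (uncur a b c) (cur a b c) }
  where
  isEquivalence : IsEquivalence _≈_
  isEquivalence = record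
    { refl  = antisym refl refl
    ; sym   = λ p → antisym (≈⇒≥ p) (≈⇒≤ p)
    ; trans = λ p q → antisym (trans (≈⇒≤ p) (≈⇒≤ q)) (trans (≈⇒≥ q) (≈⇒≥ p)) }

  monoˡ : ∀ {x y z} → x ≤ y → (x ⊙ z) ≤ (y ⊙ z)
  monoˡ p = uncur _ _ _ (trans p (cur _ _ _ refl))

  mono : ∀ {x y u v} → x ≤ y → u ≤ v → (x ⊙ u) ≤ (y ⊙ v)
  mono p q = trans (monoˡ p) (trans (comm _ _) (trans (monoˡ q) (comm _ _)))

record IsHomomorphism {c ℓ₁ ℓ₂ c′ ℓ₁′ ℓ₂′}
         (A : ResiduatedLattice c ℓ₁ ℓ₂) (B : ResiduatedLattice c′ ℓ₁′ ℓ₂′)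
         (f : ResiduatedLattice.Carrier A → ResiduatedLattice.Carrier B)
         : Set (c ⊔ ℓ₁ ⊔ ℓ₁′) where
  private
    module A = ResiduatedLattice A
    module B = ResiduatedLattice B
  field
    cong   : ∀ {x y} → x A.≈ y → f x B.≈ f y
    ∨-homo : ∀ x y → f (x A.∨ y) B.≈ (f x B.∨ f y)
    ∧-homo : ∀ x y → f (x A.∧ y) B.≈ (f x B.∧ f y)
    ⊙-homo : ∀ x y → f (x A.⊙ y) B.≈ (f x B.⊙ f y)
    ⇒-homo : ∀ x y → f (x A.⇒ y) B.≈ (f x B.⇒ f y)
    𝟘-homo : f A.𝟘 B.≈ B.𝟘
    𝟙-homo : f A.𝟙 B.≈ B.𝟙

  mono : ∀ {x y} → x A.≤ y → f x B.≤ f y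
  mono {x} {y} x≤y = B.trans
    (B.reflexive (B.Eq.trans (cong (A.Eq.sym (A.y≤x⇒x∧y≈y x≤y))) (∧-homo y x)))
    (B.x∧y≤x _ _)

module _ {c ℓ₁ ℓ₂} (A : ResiduatedLattice c ℓ₁ ℓ₂) where
  open ResiduatedLattice A

  record IsFilter {p} (F : Pred Carrier p) : Set (c ⊔ ℓ₂ ⊔ p) where
    field
      nonEmpty : ∃ F
      upward   : ∀ {x y} → x ≤ y → x ∈ F → y ∈ F
      ⊙-closed : ∀ {x y} → x ∈ F → y ∈ F → x ⊙ y ∈ F

    𝟙∈ : 𝟙 ∈ F
    𝟙∈ = upward (maximum _) (proj₂ nonEmpty)

    𝟙≤∈ : ∀ {x} → 𝟙 ≤ x → x ∈ F
    𝟙≤∈ 𝟙≤x = upward 𝟙≤x 𝟙∈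

  -- Being inductive, this is the least filter containing x.
  data Generated (x : Carrier) : Pred Carrier (c ⊔ ℓ₂) where
    generator  : x ∈ Generated x
    up-closure : ∀ {y z} → y ≤ z → y ∈ Generated x → z ∈ Generated x
    ⊙-closure  : ∀ {y z} → y ∈ Generated x → z ∈ Generated x → y ⊙ z ∈ Generated x

  Complemented : Pred Carrier (c ⊔ ℓ₁)
  Complemented e = ∃ λ f → (e ∨ f ≈ 𝟙) × (e ∧ f ≈ 𝟘)

  CoAnnihilator : ∀ {p} → Pred Carrier p → Pred Carrier (c ⊔ ℓ₁ ⊔ p)
  CoAnnihilator X a = ∀ {x} → x ∈ X → a ∨ x ≈ 𝟙

-- Setω because X ranges over subsets of every universe level. X need not respect _≈_;
-- its co-annihilator is that of its closure under _≈_.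
StronglyCoStone : ∀ {c ℓ₁ ℓ₂} → ResiduatedLattice c ℓ₁ ℓ₂ → Setω
StronglyCoStone A = ∀ {p} (X : Pred Carrier p) →
  ∃ λ e → e ∈ Complemented A × CoAnnihilator A X ≐ Generated A e
  where open ResiduatedLattice A

module _ {c ℓ₁ ℓ₂ p} (A : ResiduatedLattice c ℓ₁ ℓ₂)
         (F : Pred (ResiduatedLattice.Carrier A) p) (isFilter : IsFilter A F) where
  open ResiduatedLattice A
  open IsFilter isFilter

  -- The order a/F ≤ b/F of the quotient is a → b ∈ F.
  Quotient : ResiduatedLattice c p p
  Quotient = fromInequalities
    (λ a b → (a ⇒ b) ∧ (b ⇒ a) ∈ F) (λ a b → a ⇒ b ∈ F) _∨_ _∧_ _⊙_ _⇒_ 𝟘 𝟙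
    (upward (x∧y≤x _ _)) (upward (x∧y≤y _ _))
    (λ p q → upward (∧-greatest ⊙≤ˡ ⊙≤ʳ) (⊙-closed p q))
    (≤⇒∈ refl) tr
    (λ x y → ≤⇒∈ (x≤x∨y x y) , ≤⇒∈ (y≤x∨y x y) , λ z p q →
      upward (curry (trans (reflexive (⊙-comm _ _)) (uncurry (∨-least
        (curry (trans (reflexive (⊙-comm _ _)) (uncurry ⊙≤ˡ)))
        (curry (trans (reflexive (⊙-comm _ _)) (uncurry ⊙≤ʳ)))))))
        (⊙-closed p q))
    (λ x y → ≤⇒∈ (x∧y≤x x y) , ≤⇒∈ (x∧y≤y x y) , λ z p q →
      upward (curry (∧-greatest (uncurry ⊙≤ˡ) (uncurry ⊙≤ʳ))) (⊙-closed p q))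
    (λ x → ≤⇒∈ (maximum x)) (λ x → ≤⇒∈ (minimum x))
    (λ x y z → ≤⇒∈ (reflexive (⊙-assoc x y z)))
    (λ x y → ≤⇒∈ (reflexive (⊙-comm x y)))
    (λ x → ≤⇒∈ (reflexive (⊙-identityˡ x)))
    (λ x → ≤⇒∈ (reflexive (Eq.sym (⊙-identityˡ x))))
    (λ x y z → upward (curry (trans (reflexive (Eq.sym (⊙-assoc _ _ _))) (uncurry ⇒-eval))))
    (λ x y z → upward (curry (curry (trans (reflexive (⊙-assoc _ _ _)) ⇒-eval))))
    where
    ≤⇒∈ : ∀ {a b} → a ≤ b → a ⇒ b ∈ F
    ≤⇒∈ a≤b = 𝟙≤∈ (curry (trans ⊙≤ʳ a≤b))

    tr : ∀ {x y z} → x ⇒ y ∈ F → y ⇒ z ∈ F → x ⇒ z ∈ F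
    tr p q = upward
      (curry (trans (reflexive (⊙-assoc _ _ _)) (trans (⊙-monoʳ ⇒-eval) ⇒-eval)))
      (⊙-closed q p)

Product : ∀ {i c ℓ₁ ℓ₂} {I : Set i} →
          (I → ResiduatedLattice c ℓ₁ ℓ₂) → ResiduatedLattice (i ⊔ c) (i ⊔ ℓ₁) (i ⊔ ℓ₂)
Product {I = I} A = fromInequalities
  {Carrier = ∀ i → A.Carrier i}
  (λ x y → ∀ i → A._≈_ i (x i) (y i)) (λ x y → ∀ i → A._≤_ i (x i) (y i))
  (λ x y i → A._∨_ i (x i) (y i)) (λ x y i → A._∧_ i (x i) (y i))
  (λ x y i → A._⊙_ i (x i) (y i)) (λ x y i → A._⇒_ i (x i) (y i))
  (λ i → A.𝟘 i) (λ i → A.𝟙 i)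
  (λ p i → A.reflexive i (p i)) (λ p i → A.reflexive i (A.Eq.sym i (p i)))
  (λ p q i → A.antisym i (p i) (q i))
  (λ i → A.refl i) (λ p q i → A.trans i (p i) (q i))
  (λ x y → (λ i → A.x≤x∨y i _ _) , (λ i → A.y≤x∨y i _ _)
         , λ z p q i → A.∨-least i (p i) (q i))
  (λ x y → (λ i → A.x∧y≤x i _ _) , (λ i → A.x∧y≤y i _ _)
         , λ z p q i → A.∧-greatest i (p i) (q i))
  (λ x i → A.maximum i _) (λ x i → A.minimum i _)
  (λ x y z i → A.reflexive i (A.⊙-assoc i _ _ _))
  (λ x y i → A.reflexive i (A.⊙-comm i _ _))
  (λ x i → A.reflexive i (A.⊙-identityˡ i _))
  (λ x i → A.reflexive i (A.Eq.sym i (A.⊙-identityˡ i _)))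
  (λ x y z p i → A.uncurry i (p i)) (λ x y z p i → A.curry i (p i))
  where module A i = ResiduatedLattice (A i)

-- The index is a directed preorder. `transition` takes a proof of i ⊑ j as an
-- argument; the two laws are required for all proofs, so that in particular the
-- transition map does not depend on the proof.
record InductiveSystem i r c ℓ₁ ℓ₂ : Set (lsuc (i ⊔ r ⊔ c ⊔ ℓ₁ ⊔ ℓ₂)) where
  infix 4 _⊑_
  field
    Index   : Set i
    _⊑_     : Rel Index r
    ⊑-refl  : ∀ {i} → i ⊑ i
    ⊑-trans : ∀ {i j k} → i ⊑ j → j ⊑ k → i ⊑ k
    base    : Index
    upper   : ∀ i j → ∃ λ k → i ⊑ k × j ⊑ k
    Stage   : Index → ResiduatedLattice c ℓ₁ ℓ₂
  module S i = ResiduatedLattice (Stage i)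
  field
    transition      : ∀ {i j} → i ⊑ j → S.Carrier i → S.Carrier j
    isHomomorphism  : ∀ {i j} (h : i ⊑ j) → IsHomomorphism (Stage i) (Stage j) (transition h)
    transition-id   : ∀ {i} (h : i ⊑ i) x → S._≈_ i (transition h x) x
    transition-comp : ∀ {i j k} (h : i ⊑ j) (g : j ⊑ k) (f : i ⊑ k) x →
                      S._≈_ k (transition g (transition h x)) (transition f x)

-- The disjoint union of the stages modulo "equal at some later stage", ordered by
-- "less or equal at some later stage", with operations computed at a common stage.
module Limit {i r c ℓ₁ ℓ₂} (D : InductiveSystem i r c ℓ₁ ℓ₂) where
  open InductiveSystem D
  module H {i j} (h : i ⊑ j) = IsHomomorphism (isHomomorphism h)

  L : Set (i ⊔ c)
  L = Σ Index S.Carrier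

  Holds : ∀ {ℓ} → (∀ k → Rel (S.Carrier k) ℓ) → Rel L (i ⊔ r ⊔ ℓ)
  Holds _~_ (i , a) (j , b) =
    ∃ λ k → Σ (i ⊑ k) λ h → Σ (j ⊑ k) λ g → _~_ k (transition h a) (transition g b)

  lift : (∀ k → Op₂ (S.Carrier k)) → Op₂ L
  lift op (i , a) (j , b) =
    let k , h , g = upper i j in k , op k (transition h a) (transition g b)

  _≲_ : Rel L (i ⊔ r ⊔ ℓ₂)
  _≲_ = Holds S._≤_

  later : ∀ {i j k m a b} (h : i ⊑ k) (g : j ⊑ k) → k ⊑ m → (p : i ⊑ m) (q : j ⊑ m) →
          S._≤_ k (transition h a) (transition g b) →
          S._≤_ m (transition p a) (transition q b)
  later {m = m} h g f p q a≤b =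
    S.trans m (S.reflexive m (S.Eq.sym m (transition-comp h f p _)))
      (S.trans m (H.mono f a≤b) (S.reflexive m (transition-comp g f q _)))

  module AtStage
    (op   : ∀ k → Op₂ (S.Carrier k))
    (cong : ∀ k {a b c d} → S._≈_ k a b → S._≈_ k c d → S._≈_ k (op k a c) (op k b d))
    (homo : ∀ {i j} (h : i ⊑ j) a b →
            S._≈_ j (transition h (op i a b)) (op j (transition h a) (transition h b)))
    where
    at : ∀ {i j k m a b} (h : i ⊑ k) (g : j ⊑ k) (f : k ⊑ m) (p : i ⊑ m) (q : j ⊑ m) →
         S._≈_ m (transition f (op k (transition h a) (transition g b)))
                 (op m (transition p a) (transition q b))
    at {m = m} h g f p q = S.Eq.trans m (homo f _ _)
      (cong m (transition-comp h f p _) (transition-comp g f q _))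

  open AtStage S._∨_ S.∨-cong H.∨-homo renaming (at to ∨-at)
  open AtStage S._∧_ S.∧-cong H.∧-homo renaming (at to ∧-at)
  open AtStage S._⊙_ S.⊙-cong H.⊙-homo renaming (at to ⊙-at)
  open AtStage S._⇒_ S.⇒-cong H.⇒-homo renaming (at to ⇒-at)

  ≲-refl : ∀ {x} → x ≲ x
  ≲-refl {i , a} = i , ⊑-refl , ⊑-refl , S.refl i

  ≲-trans : ∀ {x y z} → x ≲ y → y ≲ z → x ≲ z
  ≲-trans (k , h , g , p) (l , h′ , g′ , q) =
    let m , f , f′ = upper k l in
    m , ⊑-trans h f , ⊑-trans g′ f′ ,
    S.trans m (later h g f _ (⊑-trans g f) p) (later h′ g′ f′ _ _ q)

  ∨-sup : Supremum _≲_ (lift S._∨_)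
  ∨-sup (i , a) (j , b) =
    let e , u , v = upper i j in
    (e , u , ⊑-refl , S.trans e (S.x≤x∨y e _ _) (S.reflexive e (S.Eq.sym e (transition-id _ _)))) ,
    (e , v , ⊑-refl , S.trans e (S.y≤x∨y e _ _) (S.reflexive e (S.Eq.sym e (transition-id _ _)))) ,
    λ { (l , d) (k , h , g , p) (k′ , h′ , g′ , q) →
      let n , f , f′ = upper k k′
          m , w , w′ = upper e n
      in m , w , ⊑-trans g (⊑-trans f w′) ,
         S.trans m (S.reflexive m (∨-at u v w (⊑-trans u w) (⊑-trans v w)))
           (S.∨-least m (later h g (⊑-trans f w′) _ _ p) (later h′ g′ (⊑-trans f′ w′) _ _ q)) }

  ∧-inf : Infimum _≲_ (lift S._∧_)
  ∧-inf (i , a) (j , b) =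
    let e , u , v = upper i j in
    (e , ⊑-refl , u , S.trans e (S.reflexive e (transition-id _ _)) (S.x∧y≤x e _ _)) ,
    (e , ⊑-refl , v , S.trans e (S.reflexive e (transition-id _ _)) (S.x∧y≤y e _ _)) ,
    λ { (l , d) (k , h , g , p) (k′ , h′ , g′ , q) →
      let n , f , f′ = upper k k′
          m , w , w′ = upper e n
      in m , ⊑-trans h (⊑-trans f w′) , w ,
         S.trans m
           (S.∧-greatest m (later h g (⊑-trans f w′) _ _ p) (later h′ g′ (⊑-trans f′ w′) _ _ q))
           (S.reflexive m (S.Eq.sym m (∧-at u v w (⊑-trans u w) (⊑-trans v w)))) }

  ⊙-assoc≲ : ∀ x y z → lift S._⊙_ (lift S._⊙_ x y) z ≲ lift S._⊙_ x (lift S._⊙_ y z)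
  ⊙-assoc≲ (i , a) (j , b) (l , d) =
    let e₁ , u₁ , v₁ = upper i j
        e₂ , u₂ , v₂ = upper e₁ l
        e₃ , u₃ , v₃ = upper j l
        e₄ , u₄ , v₄ = upper i e₃
        m  , w , w′  = upper e₂ e₄
        p = ⊑-trans u₄ w′
        q = ⊑-trans u₁ (⊑-trans u₂ w)
        s = ⊑-trans v₁ (⊑-trans u₂ w)
        t = ⊑-trans v₂ w
        module M = ResiduatedLattice (Stage m)
    in m , w , w′ , M.reflexive
         (M.Eq.trans (⊙-at u₂ v₂ w (⊑-trans u₂ w) t)
         (M.Eq.trans (M.⊙-cong (⊙-at u₁ v₁ (⊑-trans u₂ w) p s) M.Eq.refl)
         (M.Eq.trans (M.⊙-assoc _ _ _)
         (M.Eq.sym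
         (M.Eq.trans (⊙-at u₄ v₄ w′ p (⊑-trans v₄ w′))
                     (M.⊙-cong M.Eq.refl (⊙-at u₃ v₃ (⊑-trans v₄ w′) s t)))))))

  ⊙-comm≲ : ∀ x y → lift S._⊙_ x y ≲ lift S._⊙_ y x
  ⊙-comm≲ (i , a) (j , b) =
    let e , u , v    = upper i j
        e′ , u′ , v′ = upper j i
        m , w , w′   = upper e e′
        module M = ResiduatedLattice (Stage m)
    in m , w , w′ , M.reflexive
         (M.Eq.trans (⊙-at u v w (⊑-trans u w) (⊑-trans v w))
         (M.Eq.trans (M.⊙-comm _ _)
                     (M.Eq.sym (⊙-at u′ v′ w′ (⊑-trans v w) (⊑-trans u w)))))

  𝟙⊙ : ∀ {i e} (a : S.Carrier i) (g : base ⊑ e) (h : i ⊑ e) →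
       S._≈_ e (transition (⊑-refl {e}) (S._⊙_ e (transition g (S.𝟙 base)) (transition h a)))
               (transition h a)
  𝟙⊙ {e = e} a g h = E.Eq.trans (transition-id _ _)
    (E.Eq.trans (E.⊙-cong (H.𝟙-homo g) E.Eq.refl) (E.⊙-identityˡ _))
    where module E = ResiduatedLattice (Stage e)

  uncurry≲ : ∀ x y z → x ≲ lift S._⇒_ y z → lift S._⊙_ x y ≲ z
  uncurry≲ (i , a) (j , b) (l , d) (k , h , g , p) =
    let e , u , v    = upper j l
        e′ , u′ , v′ = upper i j
        m , w , w′   = upper e′ k
        j⊑m = ⊑-trans u (⊑-trans g w′)
        l⊑m = ⊑-trans v (⊑-trans g w′)
        module M = ResiduatedLattice (Stage m)
    in m , w , l⊑m ,
       M.trans (M.reflexive (⊙-at u′ v′ w (⊑-trans h w′) j⊑m))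
         (M.uncurry (M.trans (later h g w′ _ (⊑-trans g w′) p)
                             (M.reflexive (⇒-at u v (⊑-trans g w′) j⊑m l⊑m))))

  curry≲ : ∀ x y z → lift S._⊙_ x y ≲ z → x ≲ lift S._⇒_ y z
  curry≲ (i , a) (j , b) (l , d) (k , h , g , p) =
    let e , u , v    = upper j l
        e′ , u′ , v′ = upper i j
        m , w , w′   = upper e k
        i⊑m = ⊑-trans u′ (⊑-trans h w′)
        j⊑m = ⊑-trans v′ (⊑-trans h w′)
        l⊑m = ⊑-trans g w′
        module M = ResiduatedLattice (Stage m)
    in m , i⊑m , w ,
       M.trans
         (M.curry (M.trans (M.reflexive (M.Eq.sym (⊙-at u′ v′ (⊑-trans h w′) i⊑m j⊑m)))
                           (later h g w′ _ l⊑m p)))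
         (M.reflexive (M.Eq.sym (⇒-at u v w j⊑m l⊑m)))

  DirectLimit : ResiduatedLattice (i ⊔ c) (i ⊔ r ⊔ ℓ₁) (i ⊔ r ⊔ ℓ₂)
  DirectLimit = fromInequalities
    (Holds S._≈_) (Holds S._≤_) (lift S._∨_) (lift S._∧_) (lift S._⊙_) (lift S._⇒_)
    (base , S.𝟘 base) (base , S.𝟙 base)
    (λ (k , h , g , p) → k , h , g , S.reflexive k p)
    (λ (k , h , g , p) → k , g , h , S.reflexive k (S.Eq.sym k p))
    (λ (k , h , g , p) (l , h′ , g′ , q) →
      let m , f , f′ = upper k l in
      m , ⊑-trans h f , ⊑-trans g f ,
      S.antisym m (later h g f _ _ p) (later h′ g′ f′ _ _ q))
    ≲-refl ≲-trans ∨-sup ∧-inf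
    (λ (j , b) → let m , h , g = upper j base in m , h , g ,
      S.trans m (S.maximum m _) (S.reflexive m (S.Eq.sym m (H.𝟙-homo g))))
    (λ (j , b) → let m , h , g = upper base j in m , h , g ,
      S.trans m (S.reflexive m (H.𝟘-homo h)) (S.minimum m _))
    ⊙-assoc≲ ⊙-comm≲
    (λ (j , b) → let e , g , h = upper base j in
      e , ⊑-refl , h , S.reflexive e (𝟙⊙ b g h))
    (λ (j , b) → let e , g , h = upper base j in
      e , h , ⊑-refl , S.reflexive e (S.Eq.sym e (𝟙⊙ b g h)))
    uncurry≲ curry≲

module Hull {c ℓ₁ ℓ₂} (A : ResiduatedLattice c ℓ₁ ℓ₂) where
  open ResiduatedLattice A

  infix 10 _^⊤
  _^⊤ : ∀ {p} → Pred Carrier p → Pred Carrier (c ⊔ ℓ₁ ⊔ p)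
  X ^⊤ = CoAnnihilator A X

  ｛𝟙｝ : Pred Carrier ℓ₁
  ｛𝟙｝ = _≈ 𝟙

  up≈𝟙 : ∀ {a b} → a ≤ b → a ≈ 𝟙 → b ≈ 𝟙
  up≈𝟙 a≤b a≈𝟙 = 𝟙≤⇒≈𝟙 (trans (reflexive (Eq.sym a≈𝟙)) a≤b)

  ^⊤-isFilter : ∀ {p} (X : Pred Carrier p) → IsFilter A (X ^⊤)
  ^⊤-isFilter X = record
    { nonEmpty = 𝟙 , λ _ → 𝟙≤⇒≈𝟙 (x≤x∨y _ _)
    ; upward   = λ x≤y x∈ z∈X → up≈𝟙 (∨-monotonic x≤y refl) (x∈ z∈X)
    ; ⊙-closed = λ a∈ b∈ x∈X → 𝟙≤⇒≈𝟙
        (trans (reflexive (Eq.sym (⊙-identityˡ 𝟙)))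
        (trans (⊙-mono (reflexive (Eq.sym (a∈ x∈X))) (reflexive (Eq.sym (b∈ x∈X)))) distr))
    }
    where
    distr : ∀ {a b x} → (a ∨ x) ⊙ (b ∨ x) ≤ (a ⊙ b) ∨ x
    distr = uncurry (∨-least
      (curry (trans (reflexive (⊙-comm _ _)) (uncurry (∨-least
        (curry (trans (reflexive (⊙-comm _ _)) (x≤x∨y _ _)))
        (curry (trans ⊙≤ˡ (y≤x∨y _ _)))))))
      (curry (trans ⊙≤ˡ (y≤x∨y _ _))))

  -- Under excluded middle every predicate is equivalent to one at level c ⊔ ℓ₁, so fixing
  -- this level omits no co-annihilator.
  record CoAnn : Set (lsuc (c ⊔ ℓ₁)) where
    field
      ⟦_⟧     : Pred Carrier (c ⊔ ℓ₁)
      isCoAnn : ∃ λ (X : Pred Carrier (c ⊔ ℓ₁)) → ⟦_⟧ ≐ X ^⊤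
  open CoAnn public using (⟦_⟧)

  ⋁ᵀ : ∀ {n} → (Fin n → CoAnn) → Pred Carrier (c ⊔ ℓ₁)
  ⋁ᵀ {n} F = (⋂ (Fin n) λ t → ⟦ F t ⟧ ^⊤) ^⊤

  -- A finite partition is given by a repetition-free enumeration of its blocks (distinct
  -- indices have distinct blocks by `disjoint` and `nontrivial`). Reorderings of one
  -- partition are ⊑ each other, so they do not affect the limit.
  record Partition : Set (lsuc (c ⊔ ℓ₁)) where
    field
      size       : ℕ
      block      : Fin size → CoAnn
      nontrivial : ∀ i → ¬ ⟦ block i ⟧ ≐ ｛𝟙｝
      disjoint   : ∀ {i j} → i ≢ j → ⟦ block i ⟧ ∩ ⟦ block j ⟧ ≐ ｛𝟙｝
      covering   : ⋁ᵀ block ≐ U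
  open Partition

  infix 4 _⊑_
  _⊑_ : Rel Partition (c ⊔ ℓ₁)
  𝒞 ⊑ 𝒟 = ∀ j → ∃ λ i → ⟦ block 𝒟 j ⟧ ⊆ ⟦ block 𝒞 i ⟧

  A[_] : Partition → ResiduatedLattice c (c ⊔ ℓ₁) (c ⊔ ℓ₁)
  A[ 𝒞 ] = Product λ i → Quotient A (⟦ block 𝒞 i ⟧ ^⊤) (^⊤-isFilter ⟦ block 𝒞 i ⟧)

  𝒫 : ∀ {𝒞 𝒟} → 𝒞 ⊑ 𝒟 → ResiduatedLattice.Carrier A[ 𝒞 ] → ResiduatedLattice.Carrier A[ 𝒟 ]
  𝒫 𝒞⊑𝒟 a j = a (proj₁ (𝒞⊑𝒟 j))

  𝟙∈ : ∀ (F : CoAnn) → 𝟙 ∈ ⟦ F ⟧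
  𝟙∈ F = let X , _ , X^⊤⊆F = CoAnn.isCoAnn F in X^⊤⊆F (IsFilter.𝟙∈ (^⊤-isFilter X))

  upF : ∀ (F : CoAnn) {a b} → a ≤ b → a ∈ ⟦ F ⟧ → b ∈ ⟦ F ⟧
  upF F a≤b a∈F = let X , F⊆X^⊤ , X^⊤⊆F = CoAnn.isCoAnn F in
    X^⊤⊆F (IsFilter.upward (^⊤-isFilter X) a≤b (F⊆X^⊤ a∈F))

  ⊆｛𝟙｝⇒≐ : ∀ (F : CoAnn) → ⟦ F ⟧ ⊆ ｛𝟙｝ → ⟦ F ⟧ ≐ ｛𝟙｝
  ⊆｛𝟙｝⇒≐ F F⊆ = F⊆ , λ x≈𝟙 → upF F (reflexive (Eq.sym x≈𝟙)) (𝟙∈ F)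

  unique : ∀ 𝒞 (F : CoAnn) → ¬ ⟦ F ⟧ ≐ ｛𝟙｝ → ∀ {i j} →
           ⟦ F ⟧ ⊆ ⟦ block 𝒞 i ⟧ → ⟦ F ⟧ ⊆ ⟦ block 𝒞 j ⟧ → i ≡ j
  unique 𝒞 F F≠ {i} {j} F⊆i F⊆j with i ≟ j
  ... | yes i≡j = i≡j
  ... | no  i≢j = ⊥-elim (F≠ (⊆｛𝟙｝⇒≐ F λ x∈F → proj₁ (disjoint 𝒞 i≢j) (F⊆i x∈F , F⊆j x∈F)))

  𝒫-comp : ∀ {𝒞 𝒟 ℰ} (h : 𝒞 ⊑ 𝒟) (g : 𝒟 ⊑ ℰ) (f : 𝒞 ⊑ ℰ) x →
           ResiduatedLattice._≈_ A[ ℰ ] (𝒫 {𝒟} {ℰ} g (𝒫 {𝒞} {𝒟} h x)) (𝒫 {𝒞} {ℰ} f x)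
  𝒫-comp {𝒞} {𝒟} {ℰ} h g f x j
    with h (proj₁ (g j)) | f j
  ... | i , D⊆ | i′ , E⊆
    with unique 𝒞 (block ℰ j) (nontrivial ℰ j) {i} {i′} (λ z → D⊆ (proj₂ (g j) z)) E⊆
  ... | ≡.refl = ResiduatedLattice.Eq.refl
                   (Quotient A (⟦ block ℰ j ⟧ ^⊤) (^⊤-isFilter ⟦ block ℰ j ⟧)) {x i}

  𝒫-id : ∀ {𝒞} (h : 𝒞 ⊑ 𝒞) x → ResiduatedLattice._≈_ A[ 𝒞 ] (𝒫 {𝒞} {𝒞} h x) x
  𝒫-id {𝒞} h x j with h j
  ... | i , C⊆ with unique 𝒞 (block 𝒞 j) (nontrivial 𝒞 j) {i} {j} C⊆ (λ z → z)
  ... | ≡.refl = ResiduatedLattice.Eq.refl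
                   (Quotient A (⟦ block 𝒞 j ⟧ ^⊤) (^⊤-isFilter ⟦ block 𝒞 j ⟧)) {x i}

  𝒫-hom : ∀ {𝒞 𝒟} (h : 𝒞 ⊑ 𝒟) → IsHomomorphism A[ 𝒞 ] A[ 𝒟 ] (𝒫 {𝒞} {𝒟} h)
  𝒫-hom {𝒞} {𝒟} h = record
    { cong   = λ x≈y j d∈D → x≈y (proj₁ (h j)) (proj₂ (h j) d∈D)
    ; ∨-homo = λ x y → D.Eq.refl {𝒫 {𝒞} {𝒟} h (x C.∨ y)}
    ; ∧-homo = λ x y → D.Eq.refl {𝒫 {𝒞} {𝒟} h (x C.∧ y)}
    ; ⊙-homo = λ x y → D.Eq.refl {𝒫 {𝒞} {𝒟} h (x C.⊙ y)}
    ; ⇒-homo = λ x y → D.Eq.refl {𝒫 {𝒞} {𝒟} h (x C.⇒ y)}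
    ; 𝟘-homo = D.Eq.refl {D.𝟘}
    ; 𝟙-homo = D.Eq.refl {D.𝟙}
    }
    where
    module C = ResiduatedLattice A[ 𝒞 ]
    module D = ResiduatedLattice A[ 𝒟 ]

  _∩ᶜ_ : CoAnn → CoAnn → CoAnn
  F ∩ᶜ G =
    let X , F⊆ , ⊆F = CoAnn.isCoAnn F
        Y , G⊆ , ⊆G = CoAnn.isCoAnn G
    in record
      { ⟦_⟧ = ⟦ F ⟧ ∩ ⟦ G ⟧
      ; isCoAnn = X ∪ Y
        , (λ { (a∈F , a∈G) (inj₁ x∈X) → F⊆ a∈F x∈X
             ; (a∈F , a∈G) (inj₂ y∈Y) → G⊆ a∈G y∈Y })
        , (λ a∈ → ⊆F (λ x∈X → a∈ (inj₁ x∈X)) , ⊆G (λ y∈Y → a∈ (inj₂ y∈Y)))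
      }

  Aᶜ : CoAnn
  Aᶜ = record
    { ⟦_⟧ = λ _ → ⊤
    ; isCoAnn = (λ _ → ⊥) , (λ _ ()) , λ _ → _ }

  lookup-injective : ∀ {a} {B : Set a} {xs : List B} → Unique xs →
                     ∀ i j → lookup xs i ≡ lookup xs j → i ≡ j
  lookup-injective (_ ∷ _)   zero    zero    _  = ≡.refl
  lookup-injective {xs = x ∷ xs} (x∉ ∷ _) zero (suc j) eq = ⊥-elim (All.lookup x∉ (∈-lookup j) eq)
  lookup-injective {xs = x ∷ xs} (x∉ ∷ _) (suc i) zero eq = ⊥-elim (All.lookup x∉ (∈-lookup i) (≡.sym eq))
  lookup-injective (_ ∷ xs!) (suc i) (suc j) eq = ≡.cong suc (lookup-injective xs! i j eq)

  covers : ∀ {n} (F : Fin n → CoAnn) →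
           (∀ {b} → (∀ i → b ∈ ⟦ F i ⟧ ^⊤) → b ≈ 𝟙) → ⋁ᵀ F ≐ U
  covers F only𝟙 = (λ _ → _) , λ _ b∈ → up≈𝟙 (y≤x∨y _ _) (only𝟙 b∈)

  covers⁻¹ : ∀ 𝒞 {b} → (∀ i → b ∈ ⟦ block 𝒞 i ⟧ ^⊤) → b ≈ 𝟙
  covers⁻¹ 𝒞 b∈ = up≈𝟙 (∨-least refl refl) (proj₂ (covering 𝒞) _ b∈)

  -- Blocks must differ from {1}, so directedness requires deciding which intersections
  -- C ∩ D are {1}, and a first partition requires deciding whether A is trivial.
  module _ (em : ExcludedMiddle (c ⊔ ℓ₁)) where

    commonRefinement : ∀ 𝒞 𝒟 → ∃ λ ℰ → 𝒞 ⊑ ℰ × 𝒟 ⊑ ℰ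
    commonRefinement 𝒞 𝒟 = ℰ , (λ k → proj₁ (pair k) , proj₁) , (λ k → proj₂ (pair k) , proj₂)
      where
      meet : Fin (size 𝒞) × Fin (size 𝒟) → CoAnn
      meet (i , j) = block 𝒞 i ∩ᶜ block 𝒟 j

      nontrivial? : ∀ ij → Dec (¬ ⟦ meet ij ⟧ ≐ ｛𝟙｝)
      nontrivial? ij = ¬? em

      all = cartesianProduct (allFin (size 𝒞)) (allFin (size 𝒟))

      pairs : List (Fin (size 𝒞) × Fin (size 𝒟))
      pairs = filter nontrivial? all

      pairs! : Unique pairs
      pairs! = Unique.filter⁺ nontrivial?
        (Unique.cartesianProduct⁺ (Unique.allFin⁺ (size 𝒞)) (Unique.allFin⁺ (size 𝒟)))

      pair : Fin (length pairs) → Fin (size 𝒞) × Fin (size 𝒟)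
      pair = lookup pairs

      everywhere : ∀ {b} → (∀ k → b ∈ ⟦ meet (pair k) ⟧ ^⊤) → ∀ ij → b ∈ ⟦ meet ij ⟧ ^⊤
      everywhere {b} b∈ ij {x} x∈ with em {⟦ meet ij ⟧ ≐ ｛𝟙｝}
      ... | yes triv = up≈𝟙 (y≤x∨y _ _) (proj₁ triv x∈)
      ... | no  nont = b∈ (index ij∈) (≡.subst (λ kl → x ∈ ⟦ meet kl ⟧) (lookup-index ij∈) x∈)
        where
        ij∈ : ij ∈ˡ pairs
        ij∈ = ∈-filter⁺ nontrivial? (∈-cartesianProduct⁺ (∈-allFin _) (∈-allFin _)) nont

      disj : ∀ ij kl → ij ≢ kl → ⟦ meet ij ⟧ ∩ ⟦ meet kl ⟧ ⊆ ｛𝟙｝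
      disj (i , j) (k , l) ij≢kl ((xi , xj) , (xk , xl)) with i ≟ k
      ... | no i≢k = proj₁ (disjoint 𝒞 i≢k) (xi , xk)
      ... | yes ≡.refl with j ≟ l
      ...   | no j≢l     = proj₁ (disjoint 𝒟 j≢l) (xj , xl)
      ...   | yes ≡.refl = ⊥-elim (ij≢kl ≡.refl)

      ∨-assoc𝟙 : ∀ {a b d} → a ∨ (b ∨ d) ≈ 𝟙 → (a ∨ b) ∨ d ≈ 𝟙
      ∨-assoc𝟙 = up≈𝟙 (∨-least (trans (x≤x∨y _ _) (x≤x∨y _ _))
                      (∨-least (trans (y≤x∨y _ _) (x≤x∨y _ _)) (y≤x∨y _ _)))

      ℰ : Partition
      ℰ = record
        { size       = length pairs
        ; block      = meet ∘ pair
        ; nontrivial = λ k → proj₂ (∈-filter⁻ nontrivial? {xs = all} (∈-lookup k))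
        ; disjoint   = λ {k} {l} k≢l →
            ⊆｛𝟙｝⇒≐ (meet (pair k) ∩ᶜ meet (pair l))
              (disj (pair k) (pair l) (k≢l ∘ lookup-injective pairs! k l))
        ; covering   = covers (meet ∘ pair) λ b∈ →
            covers⁻¹ 𝒞 λ i {x} x∈ → covers⁻¹ 𝒟 λ j {y} y∈ →
              ∨-assoc𝟙 (everywhere b∈ (i , j)
                (upF (block 𝒞 i) (x≤x∨y x y) x∈ , upF (block 𝒟 j) (y≤x∨y x y) y∈))
        }

    -- {A}, or the empty partition when A is trivial.
    coarsest : Partition
    coarsest with em {⟦ Aᶜ ⟧ ≐ ｛𝟙｝}
    ... | yes triv = record
      { size = 0 ; block = λ () ; nontrivial = λ () ; disjoint = λ { {()} }
      ; covering = covers (λ ()) λ _ → proj₁ triv _ }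
    ... | no nont = record
      { size = 1 ; block = λ _ → Aᶜ ; nontrivial = λ _ → nont
      ; disjoint = λ { {zero} {zero} i≢i → ⊥-elim (i≢i ≡.refl) }
      ; covering = covers (λ _ → Aᶜ) λ b∈ → up≈𝟙 (∨-least refl refl) (b∈ zero _) }

    system : InductiveSystem (lsuc (c ⊔ ℓ₁)) (c ⊔ ℓ₁) c (c ⊔ ℓ₁) (c ⊔ ℓ₁)
    system = record
      { Index           = Partition
      ; _⊑_             = _⊑_
      ; ⊑-refl          = λ j → j , λ x∈ → x∈
      ; ⊑-trans         = λ h g j → proj₁ (h (proj₁ (g j))) , λ x∈ → proj₂ (h (proj₁ (g j))) (proj₂ (g j) x∈)
      ; base            = coarsest
      ; upper           = commonRefinement
      ; Stage           = A[_]
      ; transition      = λ {𝒞} {𝒟} → 𝒫 {𝒞} {𝒟}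
      ; isHomomorphism  = λ {𝒞} {𝒟} → 𝒫-hom {𝒞} {𝒟}
      ; transition-id   = λ {𝒞} → 𝒫-id {𝒞}
      ; transition-comp = λ {𝒞} {𝒟} {ℰ} → 𝒫-comp {𝒞} {𝒟} {ℰ}
      }

stronglyCoStoneHull : ∀ {c ℓ₁ ℓ₂} → ExcludedMiddle (c ⊔ ℓ₁) → ResiduatedLattice c ℓ₁ ℓ₂ →
                      ResiduatedLattice (lsuc (c ⊔ ℓ₁)) (lsuc (c ⊔ ℓ₁)) (lsuc (c ⊔ ℓ₁))
stronglyCoStoneHull em A = Limit.DirectLimit (Hull.system A em)

{-# OPTIONS --safe #-}
module Submission where

open import Defs
open import Axiom.ExcludedMiddle using (ExcludedMiddle)
open import Level using (Level; Lift; lift; _⊔_)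
open import Data.Empty using (⊥-elim)
open import Data.Fin.Base using (Fin; zero; suc)
open import Data.Fin.Properties using (_≟_)
open import Data.List.Base using (List; length; lookup; filter; allFin)
open import Data.List.Membership.Propositional using () renaming (_∈_ to _∈ˡ_)
open import Data.List.Membership.Propositional.Properties using (∈-filter⁺; ∈-filter⁻; ∈-allFin; ∈-lookup)
open import Data.List.Relation.Unary.Any using (index)
open import Data.List.Relation.Unary.Any.Properties using (lookup-index)
open import Data.List.Relation.Unary.Unique.Propositional using (Unique)
import Data.List.Relation.Unary.Unique.Propositional.Properties as Unique
open import Data.Product.Base using (∃; _×_; _,_; proj₁; proj₂; -,_)
open import Data.Sum.Base using (_⊎_; inj₁; inj₂)
open import Function.Base using (_∘_; id)
open import Relation.Binary.PropositionalEquality.Core as ≡ using (_≡_; _≢_)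
open import Relation.Nullary using (¬_; Dec; yes; no)
open import Relation.Nullary.Decidable using (¬?; True; toWitness; fromWitness)
open import Relation.Unary using (Pred; _∈_; _⊆_; _≐_; _∩_)

-- Read an element x of the hull as a family (a_C) over a partition. Then x ∨ y = 1 means
-- a_C ∨ b_D ∈ (C ∩ D)^⊤ for all blocks C of x and D of y, in other words every b_D ∨ d with
-- d ∈ D is orthogonal to every a_C ∨ c with c ∈ C. So let Y ⊆ A collect the elements a_C ∨ c
-- over all members of X and put F = Y^⊤: the co-annihilator of X is generated by the
-- element that is 0 on the block F and 1 on the block F^⊤.

private variable
  c ℓ₁ ℓ₂ : Level

Generated-least : ∀ {p} (A : ResiduatedLattice c ℓ₁ ℓ₂) {F : Pred (ResiduatedLattice.Carrier A) p} →
                  IsFilter A F → ∀ {x} → x ∈ F → Generated A x ⊆ F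
Generated-least A isF x∈F generator          = x∈F
Generated-least A isF x∈F (up-closure y≤z y) = IsFilter.upward isF y≤z (Generated-least A isF x∈F y)
Generated-least A isF x∈F (⊙-closure y z)    =
  IsFilter.⊙-closed isF (Generated-least A isF x∈F y) (Generated-least A isF x∈F z)

module _ {i r} (D : InductiveSystem i r c ℓ₁ ℓ₂) where
  open InductiveSystem D
  open Limit D
  open AtStage S._∨_ S.∨-cong H.∨-homo renaming (at to ∨-at)
  open AtStage S._∧_ S.∧-cong H.∧-homo renaming (at to ∧-at)
  private module L = ResiduatedLattice DirectLimit

  -- The insertion of a stage into the limit preserves `∨`, `∧` and the bounds. Each chain passes
  -- through the operation computed at stage `i` itself, because the limit computes it at
  -- `upper i i` and places its bounds at `base`.
  stage-complemented : ∀ {i x} → x ∈ Complemented (Stage i) → (i , x) ∈ Complemented DirectLimit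
  stage-complemented {i} {x} (y , x∨y≈𝟙 , x∧y≈𝟘) = (i , y)
    , L.Eq.trans {i = (i , x) L.∨ (i , y)} {j = i , S._∨_ i x y} {k = L.𝟙}
        (let e , u , v = upper i i in e , ⊑-refl , u ,
          S.Eq.trans e (∨-at u v ⊑-refl u u) (S.Eq.sym e (H.∨-homo u x y)))
        (let e , u , v = upper i base in e , u , v ,
          S.Eq.trans e (H.cong u x∨y≈𝟙) (S.Eq.trans e (H.𝟙-homo u) (S.Eq.sym e (H.𝟙-homo v))))
    , L.Eq.trans {i = (i , x) L.∧ (i , y)} {j = i , S._∧_ i x y} {k = L.𝟘}
        (let e , u , v = upper i i in e , ⊑-refl , u ,
          S.Eq.trans e (∧-at u v ⊑-refl u u) (S.Eq.sym e (H.∧-homo u x y)))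
        (let e , u , v = upper i base in e , u , v ,
          S.Eq.trans e (H.cong u x∧y≈𝟘) (S.Eq.trans e (H.𝟘-homo u) (S.Eq.sym e (H.𝟘-homo v))))

module _ (A : ResiduatedLattice c ℓ₁ ℓ₂) where
  open ResiduatedLattice A
  open Hull A
  open Partition

  𝟙⇒≤ : ∀ {a} → 𝟙 ⇒ a ≤ a
  𝟙⇒≤ = trans (reflexive (Eq.sym (⊙-identityʳ _))) ⇒-eval

  ≤𝟙⇒ : ∀ {a b} → a ≤ b ⇒ a
  ≤𝟙⇒ = curry ⊙≤ˡ

  ≤⇒𝟙≤⇒ : ∀ {a b} → a ≤ b → 𝟙 ≤ a ⇒ b
  ≤⇒𝟙≤⇒ a≤b = curry (trans ⊙≤ʳ a≤b)

  quotient-refl : ∀ {p} (X : Pred Carrier p) {a b} → a ≈ b → (a ⇒ b) ∧ (b ⇒ a) ∈ X ^⊤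
  quotient-refl X a≈b = IsFilter.𝟙≤∈ (^⊤-isFilter X)
    (∧-greatest (≤⇒𝟙≤⇒ (reflexive a≈b)) (≤⇒𝟙≤⇒ (reflexive (Eq.sym a≈b))))

  -- Otherwise `z` would lie in two distinct blocks of `𝒞`, which meet only in 1.
  block-unique : ∀ 𝒞 ℰ (h : 𝒞 ⊑ ℰ) {i n z} → z ∈ ⟦ block 𝒞 i ⟧ → z ∈ ⟦ block ℰ n ⟧ →
            z ≈ 𝟙 ⊎ proj₁ (h n) ≡ i
  block-unique 𝒞 ℰ h {i} {n} z∈C z∈E with proj₁ (h n) ≟ i
  ... | yes eq = inj₂ eq
  ... | no neq = inj₁ (proj₁ (disjoint 𝒞 neq) (proj₂ (h n) z∈E , z∈C))

  module _ (em : ExcludedMiddle (c ⊔ ℓ₁)) where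
    private
      module Ã = ResiduatedLattice (stronglyCoStoneHull em A)
      base : Partition
      base = coarsest em

    -- Every block of the common refinement lies in some `C ∩ D`, and co-annihilators reverse
    -- inclusion.
    ≤⁺ : ∀ 𝒞 𝒟 {a b} →
         (∀ i j → a i ⇒ b j ∈ (⟦ block 𝒞 i ⟧ ∩ ⟦ block 𝒟 j ⟧) ^⊤) → (𝒞 , a) Ã.≤ (𝒟 , b)
    ≤⁺ 𝒞 𝒟 a⇒b = let ℰ , u , v = commonRefinement em 𝒞 𝒟 in
      ℰ , u , v , λ n z∈ → a⇒b (proj₁ (u n)) (proj₁ (v n)) (proj₂ (u n) z∈ , proj₂ (v n) z∈)

    ∨≈𝟙⁺ : ∀ 𝒞 𝒟 {a b} →
           (∀ i j → a i ∨ b j ∈ (⟦ block 𝒞 i ⟧ ∩ ⟦ block 𝒟 j ⟧) ^⊤) →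
           (𝒞 , a) Ã.∨ (𝒟 , b) Ã.≈ Ã.𝟙
    ∨≈𝟙⁺ 𝒞 𝒟 a∨b =
      let ℰ , u , v = commonRefinement em 𝒞 𝒟
          ℱ , h , g = commonRefinement em ℰ base
      in ℱ , h , g , λ n z∈ →
        let m = proj₁ (h n) ; z∈E = proj₂ (h n) z∈ in
        -- Since `x ≤ (x ⇒ 𝟙) ∧ (𝟙 ⇒ x)`, membership of `x` in the filter already makes `x`
        -- congruent to `𝟙`.
        up≈𝟙 (∨-monotonic (∧-greatest (trans (maximum _) (≤⇒𝟙≤⇒ (maximum _))) ≤𝟙⇒) refl)
             (a∨b (proj₁ (u m)) (proj₁ (v m)) (proj₂ (u m) z∈E , proj₂ (v m) z∈E))

    -- The hypothesis speaks of blocks of a refinement `ℱ` only, so the covering property is used to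
    -- test the claim on each of them. For `w` in such a block, `z ∨ w` lies in that block, in `C`
    -- and in `D`; hence `z ∨ w` is 1 or the block is contained in both `C` and `D`.
    ∨≈𝟙⁻ : ∀ 𝒞 𝒟 {a b} → (𝒞 , a) Ã.∨ (𝒟 , b) Ã.≈ Ã.𝟙 →
           ∀ i j → a i ∨ b j ∈ (⟦ block 𝒞 i ⟧ ∩ ⟦ block 𝒟 j ⟧) ^⊤
    ∨≈𝟙⁻ 𝒞 𝒟 {a} {b} (ℱ , h , g , p) i j {z} (z∈C , z∈D) = covers⁻¹ ℱ in-block
      where
      ℰ = proj₁ (commonRefinement em 𝒞 𝒟)
      -- The index maps are composed through `ℰ` exactly as in `p`, so that matching on `≡.refl`
      -- turns the coordinates in `p n` into `a i` and `b j`.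
      ⊑ℱ : ∀ ℬ → ℬ ⊑ ℰ → ℬ ⊑ ℱ
      ⊑ℱ ℬ u n = -, proj₂ (u (proj₁ (h n))) ∘ proj₂ (h n)
      u : 𝒞 ⊑ ℱ
      u = ⊑ℱ 𝒞 (proj₁ (proj₂ (commonRefinement em 𝒞 𝒟)))
      v : 𝒟 ⊑ ℱ
      v = ⊑ℱ 𝒟 (proj₂ (proj₂ (commonRefinement em 𝒞 𝒟)))

      in-block : ∀ n → (a i ∨ b j) ∨ z ∈ ⟦ block ℱ n ⟧ ^⊤
      in-block n {w} w∈
        with block-unique 𝒞 ℱ u {i} {n} (upF (block 𝒞 i) (x≤x∨y z w) z∈C) (upF (block ℱ n) (y≤x∨y z w) w∈)
           | block-unique 𝒟 ℱ v {j} {n} (upF (block 𝒟 j) (x≤x∨y z w) z∈D) (upF (block ℱ n) (y≤x∨y z w) w∈)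
      ... | inj₁ z∨w≈𝟙  | _           = up≈𝟙 (∨-monotonic (y≤x∨y _ _) refl) z∨w≈𝟙
      ... | inj₂ _      | inj₁ z∨w≈𝟙  = up≈𝟙 (∨-monotonic (y≤x∨y _ _) refl) z∨w≈𝟙
      ... | inj₂ ≡.refl | inj₂ ≡.refl =
        up≈𝟙 (∨-monotonic (trans (x∧y≤y _ _) (trans 𝟙⇒≤ (x≤x∨y _ _))) refl) (p n w∈)

    -- Needed because a co-annihilator or its complement may be {1}, which is not allowed as a
    -- block.
    module NontrivialPart
      {n} (F : Fin n → CoAnn)
      (disj : ∀ {i j} → i ≢ j → ⟦ F i ⟧ ∩ ⟦ F j ⟧ ⊆ ｛𝟙｝)
      (cover : ∀ {b} → (∀ i → b ∈ ⟦ F i ⟧ ^⊤) → b ≈ 𝟙) where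

      nontrivial? : ∀ i → Dec (¬ ⟦ F i ⟧ ≐ ｛𝟙｝)
      nontrivial? i = ¬? em

      kept : List (Fin n)
      kept = filter nontrivial? (allFin n)

      kept! : Unique kept
      kept! = Unique.filter⁺ nontrivial? (Unique.allFin⁺ n)

      origin : Fin (length kept) → Fin n
      origin = lookup kept

      -- A discarded member contains only 1, to which every element is orthogonal, so covering
      -- survives.
      everywhere : ∀ {b} → (∀ k → b ∈ ⟦ F (origin k) ⟧ ^⊤) → ∀ i → b ∈ ⟦ F i ⟧ ^⊤
      everywhere b∈ i {x} x∈ with em {⟦ F i ⟧ ≐ ｛𝟙｝}
      ... | yes triv = up≈𝟙 (y≤x∨y _ _) (proj₁ triv x∈)
      ... | no  nont = b∈ (index i∈) (≡.subst (λ j → x ∈ ⟦ F j ⟧) (lookup-index i∈) x∈)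
        where
        i∈ : i ∈ˡ kept
        i∈ = ∈-filter⁺ nontrivial? (∈-allFin i) nont

      partition : Partition
      partition = record
        { size       = length kept
        ; block      = F ∘ origin
        ; nontrivial = λ k → proj₂ (∈-filter⁻ nontrivial? {xs = allFin n} (∈-lookup k))
        ; disjoint   = λ {k} {l} k≢l → ⊆｛𝟙｝⇒≐ (F (origin k) ∩ᶜ F (origin l))
            (disj (k≢l ∘ lookup-injective kept! k l))
        ; covering   = covers (F ∘ origin) λ b∈ → cover (everywhere b∈)
        }

    module Bipartition (F : CoAnn) where
      part : Fin 2 → CoAnn
      part zero       = F
      part (suc zero) = record { ⟦_⟧ = ⟦ F ⟧ ^⊤ ; isCoAnn = ⟦ F ⟧ , id , id }

      part-disjoint : ∀ {i j} → i ≢ j → ⟦ part i ⟧ ∩ ⟦ part j ⟧ ⊆ ｛𝟙｝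
      part-disjoint {zero}     {zero}     i≢j _         = ⊥-elim (i≢j ≡.refl)
      part-disjoint {zero}     {suc zero} _   (x∈ , x⊥) = up≈𝟙 (∨-least refl refl) (x⊥ x∈)
      part-disjoint {suc zero} {zero}     _   (x⊥ , x∈) = up≈𝟙 (∨-least refl refl) (x⊥ x∈)
      part-disjoint {suc zero} {suc zero} i≢j _         = ⊥-elim (i≢j ≡.refl)

      -- Being orthogonal to `F`, `b` lies in `F^⊤`; being orthogonal to `F^⊤` as well, it is
      -- orthogonal to itself.
      part-covers : ∀ {b} → (∀ i → b ∈ ⟦ part i ⟧ ^⊤) → b ≈ 𝟙
      part-covers b∈ = up≈𝟙 (∨-least refl refl) (b∈ (suc zero) (b∈ zero))

      open NontrivialPart part part-disjoint part-covers public

      value covalue : Fin 2 → Carrier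
      value zero         = 𝟘
      value (suc zero)   = 𝟙
      covalue zero       = 𝟙
      covalue (suc zero) = 𝟘

      value-∨ : ∀ i → value i ∨ covalue i ≈ 𝟙
      value-∨ zero       = 𝟙≤⇒≈𝟙 (y≤x∨y _ _)
      value-∨ (suc zero) = 𝟙≤⇒≈𝟙 (x≤x∨y _ _)

      value-∧ : ∀ i → value i ∧ covalue i ≈ 𝟘
      value-∧ zero       = antisym (x∧y≤x _ _) (minimum _)
      value-∧ (suc zero) = antisym (x∧y≤y _ _) (minimum _)

      indicator : Ã.Carrier
      indicator = partition , value ∘ origin

      indicator-complemented : indicator ∈ Complemented (stronglyCoStoneHull em A)
      indicator-complemented = stage-complemented (system em) {partition} {value ∘ origin}
        ( covalue ∘ origin
        , (λ k → quotient-refl ⟦ block partition k ⟧ (value-∨ (origin k)))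
        , (λ k → quotient-refl ⟦ block partition k ⟧ (value-∧ (origin k))) )

module _ (em : ∀ {ℓ} → ExcludedMiddle ℓ) where

  -- `True` replaces a proposition by its truth value at the lowest level, from which `Lift` reaches
  -- any level. `CoAnn` takes predicates at level `c ⊔ ℓ₁`, whereas the level of `Y` depends on that
  -- of `X`.
  Resize : ∀ {a p} {B : Set a} (q : Level) → Pred B p → Pred B q
  Resize q P b = Lift q (True (em {P = P b}))

  module _ {p} (A : ResiduatedLattice c ℓ₁ ℓ₂)
           (X : Pred (ResiduatedLattice.Carrier (stronglyCoStoneHull em A)) p) where
    open ResiduatedLattice A
    open Hull A
    open Partition
    private module Ã = ResiduatedLattice (stronglyCoStoneHull em A)

    -- Joining with `z` from the block makes the element independent, up to `_≈_`, of the
    -- representative `a i` of its class.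
    Y : Pred Carrier _
    Y y = ∃ λ ((𝒞 , a) : Ã.Carrier) → (𝒞 , a) ∈ X ×
          ∃ λ i → ∃ λ z → z ∈ ⟦ block 𝒞 i ⟧ × y ≡ a i ∨ z

    Y′ : Pred Carrier (c ⊔ ℓ₁)
    Y′ = Resize (c ⊔ ℓ₁) Y

    Y^⊤ : CoAnn
    Y^⊤ = record { ⟦_⟧ = Y′ ^⊤ ; isCoAnn = Y′ , id , id }

    open Bipartition A em Y^⊤

    indicator∈X^⊤ : indicator ∈ CoAnnihilator (stronglyCoStoneHull em A) X
    indicator∈X^⊤ {𝒞 , a} x∈X = ∨≈𝟙⁺ A em partition 𝒞 λ k i → orthogonal (origin k) i
      where
      orthogonal : ∀ t i → value t ∨ a i ∈ (⟦ part t ⟧ ∩ ⟦ block 𝒞 i ⟧) ^⊤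
      orthogonal zero i {z} (z∈F , z∈C) =
        -- `z` is orthogonal to `a i ∨ z`, a member of `Y` built from `z` itself.
        up≈𝟙 (∨-least (y≤x∨y _ _) (∨-monotonic (y≤x∨y _ _) refl))
          (z∈F (lift (fromWitness ((𝒞 , a) , x∈X , i , z , z∈C , ≡.refl))))
      orthogonal (suc zero) i _ = 𝟙≤⇒≈𝟙 (trans (x≤x∨y _ _) (x≤x∨y _ _))

    -- On `F` the indicator is 0, so only `F^⊤` matters. There `z` is orthogonal to `b j ∨ z`, which
    -- belongs to `F`, and this forces `b j ∨ z` to be 1.
    X^⊤⇒indicator≤ : ∀ x → x ∈ CoAnnihilator (stronglyCoStoneHull em A) X → indicator Ã.≤ x
    X^⊤⇒indicator≤ (𝒟 , b) b∈X^⊤ = ≤⁺ A em partition 𝒟 λ k j → below (origin k) j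
      where
      b∨z∈Y^⊤ : ∀ j {z} → z ∈ ⟦ block 𝒟 j ⟧ → b j ∨ z ∈ ⟦ Y^⊤ ⟧
      b∨z∈Y^⊤ j {z} z∈D (lift y∈) with toWitness y∈
      ... | (𝒞 , a) , x∈X , i , w , w∈C , ≡.refl =
        up≈𝟙 (∨-least (∨-monotonic (x≤x∨y _ _) (x≤x∨y _ _)) (∨-monotonic (y≤x∨y _ _) (y≤x∨y _ _)))
          -- The element of the intersection of the two blocks to test against is `z ∨ w`.
          (∨≈𝟙⁻ A em 𝒟 𝒞 (b∈X^⊤ x∈X) j i
            (upF (block 𝒟 j) (x≤x∨y z w) z∈D , upF (block 𝒞 i) (y≤x∨y z w) w∈C))

      below : ∀ t j → value t ⇒ b j ∈ (⟦ part t ⟧ ∩ ⟦ block 𝒟 j ⟧) ^⊤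
      below zero j _ = 𝟙≤⇒≈𝟙 (trans (≤⇒𝟙≤⇒ A (minimum _)) (x≤x∨y _ _))
      below (suc zero) j (z∈F^⊤ , z∈D) =
        up≈𝟙 (∨-least (y≤x∨y _ _) (∨-monotonic (≤𝟙⇒ A) refl)) (z∈F^⊤ (b∨z∈Y^⊤ j z∈D))

lemma4p8 : (em : ∀ {ℓ} → ExcludedMiddle ℓ) →
    ∀ {c ℓ₁ ℓ₂} (A : ResiduatedLattice c ℓ₁ ℓ₂) → StronglyCoStone (stronglyCoStoneHull em A)
lemma4p8 em A X = indicator , indicator-complemented
  , (λ {b} b∈ → up-closure (X^⊤⇒indicator≤ em A X b (λ {x} → b∈ {x})) generator)
  , Generated-least Ã (Hull.^⊤-isFilter Ã X) (indicator∈X^⊤ em A X)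
  where
  Ã = stronglyCoStoneHull em A
  open Bipartition A em (Y^⊤ em A X)
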